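{- $T(C_{\le 4};45) = 145$, and $T(C_{\le 4};n) = 6n-126$ for each $n \in \{46,47,48,49\}$.
   Context: All graphs are finite, simple and undirected. The order of a graph is its number of vertices and its size is its number of edges. A graph has girth $\ge 5$ if it contains no cycle of length 3 or 4 (acyclic graphs are allowed). $T(C_{\le 4};n)$ denotes the maximal size of a graph of order $n$ and girth $\ge 5$. -}

module Defs where

open import Data.Fin.Base using (Fin; toℕ)
open import Data.Fin.Properties using (_<?_)
open import Data.List.Base using (List; length; filter; allFin; cartesianProduct)
open import Data.Nat.Base using (ℕ; suc; _≤_)
open import Data.Nat.DivMod using (_mod_)
open import Data.Product.Base using (_×_; _,_; ∃-syntax)
open import Function.Definitions using (Injective)
open import Level using (0ℓ)
open import Relation.Binary.Core using (Rel)
open import Relation.Binary.Definitions using (Decidable; Irreflexive; Symmetric)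
open import Relation.Binary.PropositionalEquality.Core using (_≡_)
open import Relation.Nullary.Decidable.Core using (_×-dec_)
open import Relation.Nullary.Negation.Core using (¬_)

-- Decidability of adjacency is what makes the edges of a graph countable
-- constructively; classically it is no restriction.

record Graph (n : ℕ) : Set₁ where
  infix 4 _~_ _~?_
  field
    _~_    : Rel (Fin n) 0ℓ
    _~?_   : Decidable _~_
    sym    : Symmetric _~_
    irrefl : Irreflexive _≡_ _~_

-- Each undirected edge is listed once, with its smaller endpoint first.

edges : ∀ {n} → Graph n → List (Fin n × Fin n)
edges {n} G =
  filter (λ (i , j) → (i <? j) ×-dec (i ~? j)) (cartesianProduct (allFin n) (allFin n))
  where open Graph G

size : ∀ {n} → Graph n → ℕ
size G = length (edges G)

-- Cyclic successor: the last index is followed by zero.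

next : ∀ {k} → Fin k → Fin k
next {suc m} i = suc (toℕ i) mod suc m

record Cycle {n : ℕ} (G : Graph n) (k : ℕ) : Set where
  open Graph G
  field
    3≤k       : 3 ≤ k
    vertex    : Fin k → Fin n
    injective : Injective _≡_ _≡_ vertex
    adjacent  : ∀ i → vertex i ~ vertex (next i)

Girth≥5 : ∀ {n} → Graph n → Set
Girth≥5 G = ¬ Cycle G 3 × ¬ Cycle G 4

-- The maximum is a relation between n and its value m: m is attained by
-- some graph of order n and girth ≥ 5, and bounds the size of all of them.

T[C≤4⨾_]≡_ : ℕ → ℕ → Set₁
T[C≤4⨾ n ]≡ m =
  (∃[ G ] Girth≥5 {n} G × size G ≡ m) ×
  (∀ (G : Graph n) → Girth≥5 G → size G ≤ m)

infix 4 T[C≤4⨾_]≡_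

-- Upper bound.  Girth ≥ 5 says that A² + A + I ≤ J + diag(deg) entrywise.  Let
-- χ be the indicator of the k heavy vertices (those of degree ≥ 7), z = Aχ,
-- D = ∑ χ deg, H = ∑ χ z, Q = ∑ z², and let F = ∑ m with m = 6 ∸ deg.  The
-- quadratic form at χ gives Q + H + k ≤ k² + D.  Applied to the all-ones vector,
-- a row of the inequality says that the degrees around a vertex sum to at most
-- n − 1, so a heavy vertex has few heavy neighbours; as ∑ deg m ≤ 5F, this bounds
-- H from above.  Since ∑ z = D, z must then be large on the light vertices, and
-- bounding z² below by one tangent on the heavy vertices and a steeper one on the
-- light vertices makes Q too large once there is one edge too many.  Eliminating
-- F, H and Q leaves a finite numerical check over k.
--
-- Lower bound.  Delete 1, …, 5 consecutive vertices of a 5-cycle from the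
-- Hoffman–Singleton graph.

module Submission where

open import Defs
open import Algebra.Properties.Semiring.Sum using ()
open import Data.Bool.Base using (Bool; true; false; T; not; _∧_; _∨_; if_then_else_)
open import Data.Bool.ListAction using (all)
open import Data.Bool.Properties using (∨-comm)
open import Data.Fin.Base using (Fin; zero; suc; toℕ)
open import Data.Fin.Patterns using (0F; 1F; 2F; 3F)
open import Data.Fin.Properties using (toℕ<n; toℕ-injective; _≟_)
  renaming (_<?_ to _<ᶠ?_; <-cmp to <ᶠ-cmp; suc-injective to sucᶠ-injective)
open import Data.List.Base
  using (List; []; _∷_; _++_; length; filter; map; tabulate; cartesianProduct; upTo)
open import Data.List.Membership.Propositional using (_∈_)
open import Data.List.Membership.Propositional.Properties using (∈-upTo⁺)
open import Data.List.Properties using (length-++; filter-++)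
open import Data.List.Relation.Unary.All using (lookup)
open import Data.List.Relation.Unary.All.Properties using (all⁺)
open import Data.List.Relation.Unary.Any using (Any; any?; satisfied; here; there)
open import Data.Nat.Base
open import Data.Nat.Properties hiding (_≟_)
open import Data.Nat.Tactic.RingSolver using (solve-∀)
open import Data.Product.Base using (_×_; _,_)
open import Data.Sum.Base using (inj₁; inj₂)
open import Data.Unit.Base using (tt)
open import Function.Base using (_∘_)
open import Level using (0ℓ)
open import Relation.Binary.Definitions using (tri<; tri≈; tri>)
open import Relation.Binary.PropositionalEquality
open import Relation.Nullary.Decidable.Core using (Dec; yes; no; does; _×-dec_; toWitness; T?)
open import Relation.Nullary.Negation.Core using (¬_; contradiction)
open import Relation.Unary using (Pred; Decidable)

open Algebra.Properties.Semiring.Sum +-*-semiring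
  using (sum; sum-syntax; sum-cong-≗; ∑-distrib-+; ∑-comm; *-distribˡ-sum)

-- Indicators and finite sums of natural numbers.

𝟙 : ∀ {p} {P : Set p} → Dec P → ℕ
𝟙 P? = if does P? then 1 else 0

𝟙≤1 : ∀ {p} {P : Set p} (P? : Dec P) → 𝟙 P? ≤ 1
𝟙≤1 (yes _) = ≤-refl
𝟙≤1 (no  _) = z≤n

𝟙-yes : ∀ {p} {P : Set p} (P? : Dec P) → P → 𝟙 P? ≡ 1
𝟙-yes (yes _) _ = refl
𝟙-yes (no ¬p) p = contradiction p ¬p

𝟙-no : ∀ {p} {P : Set p} (P? : Dec P) → ¬ P → 𝟙 P? ≡ 0
𝟙-no (yes p) ¬p = contradiction p ¬p
𝟙-no (no _) _ = refl

𝟙-idem : ∀ {p} {P : Set p} (P? : Dec P) → 𝟙 P? * 𝟙 P? ≡ 𝟙 P?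
𝟙-idem (yes _) = refl
𝟙-idem (no  _) = refl

∑-mono : ∀ {n} {f g : Fin n → ℕ} → (∀ i → f i ≤ g i) → sum f ≤ sum g
∑-mono {zero}  f≤g = z≤n
∑-mono {suc n} f≤g = +-mono-≤ (f≤g zero) (∑-mono (f≤g ∘ suc))

∑-const : ∀ n c → ∑[ i < n ] c ≡ n * c
∑-const zero    c = refl
∑-const (suc n) c = cong (c +_) (∑-const n c)

∑-zero : ∀ {n} {f : Fin n → ℕ} → (∀ i → f i ≡ 0) → sum f ≡ 0
∑-zero {n} f≡0 = trans (sum-cong-≗ f≡0) (trans (∑-const n 0) (*-zeroʳ n))

∑-scale : ∀ {n} c (f : Fin n → ℕ) → ∑[ i < n ] (c * f i) ≡ c * sum f
∑-scale c f = sym (*-distribˡ-sum c f)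

∑-≟ : ∀ {n} (i : Fin n) (f : Fin n → ℕ) → ∑[ j < n ] (𝟙 (i ≟ j) * f j) ≡ f i
∑-≟ {suc n} zero f = trans (cong (f zero + 0 +_) (∑-zero {n} {λ _ → 0} λ _ → refl))
                           (trans (+-identityʳ _) (+-identityʳ _))
∑-≟ {suc n} (suc i) f = ∑-≟ i (f ∘ suc)

-- Turns "at most one common neighbour" into a bound on an entry of A².
∑≤1 : ∀ {n} (f : Fin n → ℕ) → (∀ i → f i ≤ 1) →
      (∀ i j → 0 < f i → 0 < f j → i ≡ j) → sum f ≤ 1
∑≤1 {zero}  f f≤1 unique = z≤n
∑≤1 {suc n} f f≤1 unique with f zero in eq
... | zero = ∑≤1 (f ∘ suc) (f≤1 ∘ suc) λ i j p q → sucᶠ-injective (unique (suc i) (suc j) p q)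
... | suc m = begin
  suc m + sum (f ∘ suc)  ≡⟨ cong (suc m +_) (∑-zero rest) ⟩
  suc m + 0              ≡⟨ +-identityʳ _ ⟩
  suc m                  ≡⟨ eq ⟨
  f zero                 ≤⟨ f≤1 zero ⟩
  1                      ∎
  where
  open ≤-Reasoning
  rest : ∀ i → f (suc i) ≡ 0
  rest i with f (suc i) in eq′
  ... | zero  = refl
  ... | suc _ with () ← unique zero (suc i) (subst (0 <_) (sym eq) z<s) (subst (0 <_) (sym eq′) z<s)

-- Lengths of filtered lists as sums of indicators.

length-filter-map-tabulate : ∀ {A B : Set} {P : Pred B 0ℓ} (P? : Decidable P) {n}
  (g : A → B) (f : Fin n → A) →
  length (filter P? (map g (tabulate f))) ≡ ∑[ i < n ] 𝟙 (P? (g (f i)))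
length-filter-map-tabulate P? {zero}  g f = refl
length-filter-map-tabulate P? {suc n} g f with does (P? (g (f zero)))
... | true  = cong suc (length-filter-map-tabulate P? g (f ∘ suc))
... | false = length-filter-map-tabulate P? g (f ∘ suc)

length-filter-cartesianProduct : ∀ {A B : Set} {P : Pred (A × B) 0ℓ} (P? : Decidable P) {m n}
  (f : Fin m → A) (g : Fin n → B) →
  length (filter P? (cartesianProduct (tabulate f) (tabulate g)))
    ≡ ∑[ i < m ] ∑[ j < n ] 𝟙 (P? (f i , g j))
length-filter-cartesianProduct P? {zero}  f g = refl
length-filter-cartesianProduct P? {suc m} f g = begin
  length (filter P? (row ++ rest))
    ≡⟨ cong length (filter-++ P? row rest) ⟩
  length (filter P? row ++ filter P? rest)
    ≡⟨ length-++ (filter P? row) ⟩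
  length (filter P? row) + length (filter P? rest)
    ≡⟨ cong₂ _+_ (length-filter-map-tabulate P? (f zero ,_) g)
                 (length-filter-cartesianProduct P? (f ∘ suc) g) ⟩
  _ ∎
  where
  open ≡-Reasoning
  row  = map (f zero ,_) (tabulate g)
  rest = cartesianProduct (tabulate (f ∘ suc)) (tabulate g)

-- Numerical inequalities for degrees and tangents.

heavy : ℕ → ℕ
heavy d = 𝟙 (7 ≤? d)

-- Summed over all vertices, this is the linear relation between D, E, k and F.
heavy-split : ∀ d → heavy d * d + 6 ≡ d + 6 * heavy d + (6 ∸ d)
heavy-split d = by (7 ≤? d)
  where
  by : (P? : Dec (7 ≤ d)) → 𝟙 P? * d + 6 ≡ d + 6 * 𝟙 P? + (6 ∸ d)
  by (yes 7≤d) rewrite m≤n⇒m∸n≡0 (≤-trans (n≤1+n 6) 7≤d) =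
    trans (cong (_+ 6) (*-identityˡ d)) (sym (+-identityʳ (d + 6)))
  by (no 7≰d) = sym (trans (cong (_+ (6 ∸ d)) (+-identityʳ d)) (m+[n∸m]≡n (≤-pred (≰⇒> 7≰d))))

-- In a degree sum each vertex may be counted as 6, with 1 more if it is heavy, at the cost of its
-- deficiency `6 ∸ d`.
6+heavy≤ : ∀ d → 6 + heavy d ≤ d + (6 ∸ d)
6+heavy≤ d = by (7 ≤? d)
  where
  by : (P? : Dec (7 ≤ d)) → 6 + 𝟙 P? ≤ d + (6 ∸ d)
  by (yes 7≤d) = ≤-trans 7≤d (m≤m+n d _)
  by (no _)    = m≤n+m∸n 6 d

7heavy≤ : ∀ d → 7 * heavy d ≤ heavy d * d
7heavy≤ d = by (7 ≤? d)
  where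
  by : (P? : Dec (7 ≤ d)) → 7 * 𝟙 P? ≤ 𝟙 P? * d
  by (yes 7≤d) = ≤-trans 7≤d (≤-reflexive (sym (*-identityˡ d)))
  by (no _)    = z≤n

-- The deficiency vanishes unless d ≤ 5.
d*[6∸d]≤ : ∀ d → d * (6 ∸ d) ≤ 5 * (6 ∸ d)
d*[6∸d]≤ d with d ≤? 5
... | yes d≤5 = *-monoˡ-≤ (6 ∸ d) d≤5
... | no  d≰5 rewrite m≤n⇒m∸n≡0 (≰⇒> d≰5) | *-zeroʳ d = z≤n

-- (z − a)(z − a − 1) ≥ 0, without subtraction.
tangent : ∀ a z → (2 * a + 1) * z ≤ z * z + a * (a + 1)
tangent a z with ≤-total z a
... | inj₁ z≤a with (t , refl) ← m≤n⇒∃[o]m+o≡n z≤a =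
  ≤-trans (m≤m+n _ (t * t + t)) (≤-reflexive (eq z t))
  where
  eq : ∀ z t → (2 * (z + t) + 1) * z + (t * t + t) ≡ z * z + (z + t) * (z + t + 1)
  eq = solve-∀
... | inj₂ a≤z with m≤n⇒∃[o]m+o≡n a≤z
...   | (zero  , refl) = ≤-reflexive (eq a)
  where
  eq : ∀ a → (2 * a + 1) * (a + 0) ≡ (a + 0) * (a + 0) + a * (a + 1)
  eq = solve-∀
...   | (suc t , refl) = ≤-trans (m≤m+n _ (t * t + t)) (≤-reflexive (eq a t))
  where
  eq : ∀ a t → (2 * a + 1) * (a + (1 + t)) + (t * t + t) ≡ (a + (1 + t)) * (a + (1 + t)) + a * (a + 1)
  eq = solve-∀

-- The tangent at b + 1 + c off the heavy vertices, and the one at b on them.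
tangents : ∀ b c {p} {P : Set p} (P? : Dec P) z →
  let a = suc b + c in
  (2 * a + 1) * z + (suc b + a * (a + 1)) * 𝟙 P?
    ≤ z * z + 𝟙 P? * z + (2 * c + 1) * (𝟙 P? * z) + (suc b * suc b * 𝟙 P? + a * (a + 1))
-- The slopes at `b` and `a` differ by 2c + 2, so that multiple of z is added to both sides; the
-- added `suc b` completes b(b + 1) to (b + 1)².
tangents b c (yes _) z = subst₂ _≤_ (lhs b c z) (rhs b c z) (+-monoˡ-≤ _ (tangent b z))
  where
  lhs : ∀ b c z → let a = suc b + c in
    (2 * b + 1) * z + ((2 * c + 2) * z + (suc b + a * (a + 1))) ≡ (2 * a + 1) * z + (suc b + a * (a + 1)) * 1
  lhs = solve-∀
  rhs : ∀ b c z → let a = suc b + c in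
    z * z + b * (b + 1) + ((2 * c + 2) * z + (suc b + a * (a + 1)))
      ≡ z * z + 1 * z + (2 * c + 1) * (1 * z) + (suc b * suc b * 1 + a * (a + 1))
  rhs = solve-∀
tangents b c (no _) z = subst₂ _≤_ (lhs b c z) (rhs b c z) (tangent (suc b + c) z)
  where
  lhs : ∀ b c z → let a = suc b + c in
    (2 * a + 1) * z ≡ (2 * a + 1) * z + (suc b + a * (a + 1)) * 0
  lhs = solve-∀
  rhs : ∀ b c z → let a = suc b + c in
    z * z + a * (a + 1)
      ≡ z * z + 0 * z + (2 * c + 1) * (0 * z) + (suc b * suc b * 0 + a * (a + 1))
  rhs = solve-∀

-- Add γ times the row bound, 5γ times the split, the form bound and the tangent bound. The
-- multiplier γ cancels H, 5γ cancels F, and Q cancels between the last two. In the result D and E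
-- have nonnegative coefficients on the left, so lower bounds may replace them.
eliminate : ∀ n {k D E F H Q} a β γ →
  D + 6 * n ≡ E + 6 * k + F →
  6 * D + H + k ≤ n * k + 5 * F →
  Q + H + k ≤ k * k + D →
  (2 * a + 1) * D + (β + a * (a + 1)) * k ≤ Q + H + γ * H + (β * β * k + a * (a + 1) * n) →
  γ * (31 * k + 5 * E) + (γ + 2 * a) * D + (β + a * (a + 1)) * k + k
    ≤ k * k + γ * (n * k + 30 * n) + β * β * k + a * (a + 1) * n
eliminate n {k} {D} {E} {F} {H} {Q} a β γ split rows form tang =
  +-cancelˡ-≤ (γ * H + 5 * γ * F + (Q + H) + 5 * γ * D + D) _ _
    (subst₂ _≤_ (lhs n k D E F H Q a β γ) (rhs n k D E F H Q a β γ)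
      (+-mono-≤ (+-mono-≤ (*-monoʳ-≤ γ rows) (*-monoʳ-≤ (5 * γ) (≤-reflexive (sym split))))
                (+-mono-≤ form tang)))
  where
  lhs : ∀ n k D E F H Q a β γ →
    γ * (6 * D + H + k) + 5 * γ * (E + 6 * k + F)
      + (Q + H + k + ((2 * a + 1) * D + (β + a * (a + 1)) * k))
    ≡ γ * H + 5 * γ * F + (Q + H) + 5 * γ * D + D
      + (γ * (31 * k + 5 * E) + (γ + 2 * a) * D + (β + a * (a + 1)) * k + k)
  lhs = solve-∀
  rhs : ∀ n k D E F H Q a β γ →
    γ * (n * k + 5 * F) + 5 * γ * (D + 6 * n)
      + (k * k + D + (Q + H + γ * H + (β * β * k + a * (a + 1) * n)))
    ≡ γ * H + 5 * γ * F + (Q + H) + 5 * γ * D + D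
      + (k * k + γ * (n * k + 30 * n) + β * β * k + a * (a + 1) * n)
  rhs = solve-∀

-- With E the degree sum, 7k ⊔ (E + 6k − 6n) bounds the degree sum of the k
-- heavy vertices from below.
Excludes : (n E k : ℕ) → ℕ × ℕ → Set
Excludes n E k (b , c) =
  let β = suc b ; a = β + c ; γ = 2 * c + 1 in
  k * k + γ * (n * k + 30 * n) + β * β * k + a * (a + 1) * n
    < γ * (31 * k + 5 * E) + (γ + 2 * a) * (7 * k ⊔ (E + 6 * k ∸ 6 * n)) + (β + a * (a + 1)) * k + k

excludes? : ∀ n E k → Decidable (Excludes n E k)
excludes? n E k p = _ <? _

-- Found by a numerical search over 45 ≤ n ≤ 49 and k ≤ n.
tangentPoints : List (ℕ × ℕ)
tangentPoints = (1 , 2) ∷ (4 , 2) ∷ (5 , 1) ∷ (3 , 0) ∷ (0 , 0) ∷ []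

-- The number k of heavy vertices is not known in advance, so every k ≤ n is tested; the tangent
-- points may depend on k.
Excluded : ℕ → ℕ → Set
Excluded n E = ∀ {k} → k < suc n → Any (Excludes n E k) tangentPoints

excluded? : ∀ n E → Dec (Excluded n E)
excluded? n E = allUpTo? (λ k → any? (excludes? n E k) tangentPoints) (suc n)

-- The adjacency operator of a graph

module _ {n} (G : Graph n) where
  open Graph G renaming (sym to ~-sym)

  adj : Fin n → Fin n → ℕ
  adj i j = 𝟙 (i ~? j)

  adj-sym : ∀ i j → adj i j ≡ adj j i
  adj-sym i j with i ~? j
  ... | yes p = sym (𝟙-yes (j ~? i) (~-sym p))
  ... | no ¬p = sym (𝟙-no (j ~? i) (¬p ∘ ~-sym))

  A : (Fin n → ℕ) → Fin n → ℕ
  A x i = ∑[ j < n ] (adj i j * x j)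

  deg : Fin n → ℕ
  deg = A (λ _ → 1)

  -- Handshake: the edge count is added to its transpose. Adjacent vertices are distinct, so exactly
  -- one of i < j and j < i holds for each adjacent pair.
  2size≡∑deg : 2 * size G ≡ sum deg
  2size≡∑deg = begin
    2 * size G
      ≡⟨ cong (2 *_) (length-filter-cartesianProduct P? (λ i → i) (λ j → j)) ⟩
    2 * S
      ≡⟨ cong (S +_) (+-identityʳ S) ⟩
    S + S
      ≡⟨ cong (S +_) (∑-comm (λ i j → 𝟙 (P? (i , j)))) ⟩
    S + ∑[ i < n ] ∑[ j < n ] 𝟙 (P? (j , i))
      ≡⟨ ∑-distrib-+ (λ i → ∑[ j < n ] 𝟙 (P? (i , j))) _ ⟨
    ∑[ i < n ] (∑[ j < n ] 𝟙 (P? (i , j)) + ∑[ j < n ] 𝟙 (P? (j , i)))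
      ≡⟨ sum-cong-≗ (λ i → ∑-distrib-+ (λ j → 𝟙 (P? (i , j))) _) ⟨
    ∑[ i < n ] ∑[ j < n ] (𝟙 (P? (i , j)) + 𝟙 (P? (j , i)))
      ≡⟨ sum-cong-≗ (λ i → sum-cong-≗ (split i)) ⟩
    sum deg ∎
    where
    open ≡-Reasoning
    P? : Decidable (λ (i , j) → _)
    P? = λ (i , j) → (i <ᶠ? j) ×-dec (i ~? j)
    S : ℕ
    S = ∑[ i < n ] ∑[ j < n ] 𝟙 (P? (i , j))
    split : ∀ i j → 𝟙 (P? (i , j)) + 𝟙 (P? (j , i)) ≡ adj i j * 1
    split i j with i ~? j | <ᶠ-cmp i j
    ... | no i≁j  | _ = cong₂ _+_ (𝟙-no ((i <ᶠ? j) ×-dec no i≁j) λ (_ , i~j) → i≁j i~j)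
                                (𝟙-no (P? (j , i)) λ (_ , j~i) → i≁j (~-sym j~i))
    ... | yes i~j | tri< i<j _ i≯j = cong₂ _+_ (𝟙-yes ((i <ᶠ? j) ×-dec yes i~j) (i<j , i~j))
                                             (𝟙-no (P? (j , i)) λ (j<i , _) → i≯j j<i)
    ... | yes i~j | tri≈ _ i≡j _ = contradiction i~j (irrefl i≡j)
    ... | yes i~j | tri> i≮j _ i>j = cong₂ _+_ (𝟙-no ((i <ᶠ? j) ×-dec yes i~j) λ (i<j , _) → i≮j i<j)
                                             (𝟙-yes (P? (j , i)) (i>j , ~-sym i~j))

  A-mono : ∀ {x y} → (∀ i → x i ≤ y i) → ∀ i → A x i ≤ A y i
  A-mono x≤y i = ∑-mono λ j → *-monoʳ-≤ (adj i j) (x≤y j)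

  A-+ : ∀ x y i → A (λ j → x j + y j) i ≡ A x i + A y i
  A-+ x y i = trans (sum-cong-≗ λ j → *-distribˡ-+ (adj i j) (x j) (y j))
                    (∑-distrib-+ (λ j → adj i j * x j) _)

  A-scale : ∀ c x i → A (λ j → c * x j) i ≡ c * A x i
  A-scale c x i = trans (sum-cong-≗ λ j → swap (adj i j) c (x j)) (∑-scale c λ j → adj i j * x j)
    where
    swap : ∀ p q r → p * (q * r) ≡ q * (p * r)
    swap = solve-∀

  A-self-adjoint : ∀ x y → ∑[ i < n ] (x i * A y i) ≡ ∑[ i < n ] (A x i * y i)
  A-self-adjoint x y = begin
    ∑[ i < n ] (x i * A y i)
      ≡⟨ sum-cong-≗ (λ i → *-distribˡ-sum (x i) λ j → adj i j * y j) ⟩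
    ∑[ i < n ] ∑[ j < n ] (x i * (adj i j * y j))
      ≡⟨ ∑-comm (λ i j → x i * (adj i j * y j)) ⟩
    ∑[ j < n ] ∑[ i < n ] (x i * (adj i j * y j))
      ≡⟨ sum-cong-≗ (λ j → sum-cong-≗ λ i →
           trans (cong (λ a → x i * (a * y j)) (adj-sym i j)) (rearrange (x i) (adj j i) (y j))) ⟩
    ∑[ j < n ] ∑[ i < n ] (y j * (adj j i * x i))
      ≡⟨ sum-cong-≗ (λ j → trans (∑-scale (y j) λ i → adj j i * x i) (*-comm (y j) (A x j))) ⟩
    ∑[ j < n ] (A x j * y j) ∎
    where
    open ≡-Reasoning
    rearrange : ∀ p q r → p * (q * r) ≡ r * (q * p)
    rearrange = solve-∀

  -- Matrix inequalities from girth at least 5.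

  module _ (girth : Girth≥5 G) where

    no-triangle : ∀ {u v w} → u ~ v → v ~ w → ¬ w ~ u
    no-triangle {u} {v} {w} uv vw wu = let no3 , _ = girth in no3 record
      { 3≤k = ≤-refl ; vertex = vertex ; injective = injective _ _ ; adjacent = adjacent }
      where
      vertex : Fin 3 → Fin n
      vertex 0F = u
      vertex 1F = v
      vertex 2F = w
      injective : ∀ i j → vertex i ≡ vertex j → i ≡ j
      injective 0F 0F _ = refl
      injective 1F 1F _ = refl
      injective 2F 2F _ = refl
      injective 0F 1F e = contradiction uv (irrefl e)
      injective 1F 2F e = contradiction vw (irrefl e)
      injective 2F 0F e = contradiction wu (irrefl e)
      injective 1F 0F e = contradiction uv (irrefl (sym e))
      injective 2F 1F e = contradiction vw (irrefl (sym e))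
      injective 0F 2F e = contradiction wu (irrefl (sym e))
      adjacent : ∀ i → vertex i ~ vertex (next i)
      adjacent 0F = uv
      adjacent 1F = vw
      adjacent 2F = wu

    -- If also v ≢ x, the walk would be a 4-cycle, its consecutive vertices being distinct by
    -- irreflexivity. In this form, distinct u and w have at most one common neighbour.
    no-square : ∀ {u v w x} → u ~ v → v ~ w → w ~ x → x ~ u → u ≢ w → v ≡ x
    no-square {u} {v} {w} {x} uv vw wx xu u≢w with v ≟ x
    ... | yes v≡x = v≡x
    ... | no  v≢x = let _ , no4 = girth in contradiction record
      { 3≤k = n≤1+n 3 ; vertex = vertex ; injective = injective _ _ ; adjacent = adjacent } no4
      where
      vertex : Fin 4 → Fin n
      vertex 0F = u
      vertex 1F = v
      vertex 2F = w
      vertex 3F = x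
      injective : ∀ i j → vertex i ≡ vertex j → i ≡ j
      injective 0F 0F _ = refl
      injective 1F 1F _ = refl
      injective 2F 2F _ = refl
      injective 3F 3F _ = refl
      injective 0F 1F e = contradiction uv (irrefl e)
      injective 1F 2F e = contradiction vw (irrefl e)
      injective 2F 3F e = contradiction wx (irrefl e)
      injective 3F 0F e = contradiction xu (irrefl e)
      injective 1F 0F e = contradiction uv (irrefl (sym e))
      injective 2F 1F e = contradiction vw (irrefl (sym e))
      injective 3F 2F e = contradiction wx (irrefl (sym e))
      injective 0F 3F e = contradiction xu (irrefl (sym e))
      injective 0F 2F e = contradiction e u≢w
      injective 2F 0F e = contradiction (sym e) u≢w
      injective 1F 3F e = contradiction e v≢x
      injective 3F 1F e = contradiction (sym e) v≢x
      adjacent : ∀ i → vertex i ~ vertex (next i)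
      adjacent 0F = uv
      adjacent 1F = vw
      adjacent 2F = wx
      adjacent 3F = xu

    codeg : Fin n → Fin n → ℕ
    codeg u w = ∑[ v < n ] (adj u v * adj v w)

    -- The entry at (u, w) of A² + A + I ≤ J + diag(deg). On the diagonal A² has the degrees. Off
    -- it, adjacent vertices have no common neighbour, as there is no triangle, and other pairs at
    -- most one, as there is no 4-cycle.
    codeg-bound : ∀ u w → codeg u w + adj u w + 𝟙 (u ≟ w) ≤ 1 + 𝟙 (u ≟ w) * deg u
    codeg-bound u w with u ≟ w
    ... | yes refl = ≤-reflexive (begin
      codeg u u + adj u u + 1  ≡⟨ cong (λ a → codeg u u + a + 1) (𝟙-no (u ~? u) (irrefl refl)) ⟩
      codeg u u + 0 + 1        ≡⟨ cong (_+ 1) (+-identityʳ (codeg u u)) ⟩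
      codeg u u + 1            ≡⟨ +-comm (codeg u u) 1 ⟩
      1 + codeg u u            ≡⟨ cong suc (sum-cong-≗ square) ⟩
      1 + deg u                ≡⟨ cong suc (+-identityʳ (deg u)) ⟨
      1 + 1 * deg u            ∎)
      where
      open ≡-Reasoning
      square : ∀ v → adj u v * adj v u ≡ adj u v * 1
      square v rewrite adj-sym v u with u ~? v
      ... | yes _ = refl
      ... | no  _ = refl
    ... | no u≢w rewrite +-identityʳ (codeg u w + adj u w) with u ~? w
    ...   | yes uw = ≤-reflexive (cong (_+ 1) (∑-zero none))
      where
      none : ∀ v → adj u v * adj v w ≡ 0
      none v with u ~? v | v ~? w
      ... | yes uv | yes vw = contradiction (~-sym uw) (no-triangle uv vw)
      ... | yes _  | no  _  = refl
      ... | no  _  | _      = refl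
    ...   | no  _  rewrite +-identityʳ (codeg u w) = ∑≤1 _
      (λ v → *-mono-≤ (𝟙≤1 (u ~? v)) (𝟙≤1 (v ~? w)))
      unique
      where
      both : ∀ v → 0 < adj u v * adj v w → u ~ v × v ~ w
      both v p with u ~? v | v ~? w
      ... | yes uv | yes vw = uv , vw
      unique : ∀ v x → 0 < adj u v * adj v w → 0 < adj u x * adj x w → v ≡ x
      unique v x p q with (uv , vw) ← both v p | (ux , xw) ← both x q =
        no-square uv vw (~-sym xw) (~-sym ux) u≢w

    -- The entrywise inequality survives multiplication by `x`, whose entries are natural numbers,
    -- hence nonnegative.
    row-bound : ∀ x u → A (A x) u + A x u + x u ≤ sum x + x u * deg u
    row-bound x u = begin
      A (A x) u + A x u + x u
        ≡⟨ cong₂ (λ s t → s + A x u + t) AAx≡ (sym (∑-≟ u x)) ⟩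
      ∑[ w < n ] (codeg u w * x w) + A x u + ∑[ w < n ] (𝟙 (u ≟ w) * x w)
        ≡⟨ cong (_+ ∑[ w < n ] (𝟙 (u ≟ w) * x w)) (∑-distrib-+ (λ w → codeg u w * x w) _) ⟨
      ∑[ w < n ] (codeg u w * x w + adj u w * x w) + ∑[ w < n ] (𝟙 (u ≟ w) * x w)
        ≡⟨ ∑-distrib-+ (λ w → codeg u w * x w + adj u w * x w) _ ⟨
      ∑[ w < n ] (codeg u w * x w + adj u w * x w + 𝟙 (u ≟ w) * x w)
        ≡⟨ sum-cong-≗ (λ w → factor (codeg u w) (adj u w) (𝟙 (u ≟ w)) (x w)) ⟨
      ∑[ w < n ] ((codeg u w + adj u w + 𝟙 (u ≟ w)) * x w)
        ≤⟨ ∑-mono (λ w → *-monoˡ-≤ (x w) (codeg-bound u w)) ⟩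
      ∑[ w < n ] ((1 + 𝟙 (u ≟ w) * deg u) * x w)
        ≡⟨ sum-cong-≗ (λ w → expand (𝟙 (u ≟ w)) (deg u) (x w)) ⟩
      ∑[ w < n ] (x w + deg u * (𝟙 (u ≟ w) * x w))
        ≡⟨ ∑-distrib-+ x _ ⟩
      sum x + ∑[ w < n ] (deg u * (𝟙 (u ≟ w) * x w))
        ≡⟨ cong (sum x +_) (trans (∑-scale (deg u) λ w → 𝟙 (u ≟ w) * x w)
                                  (cong (deg u *_) (∑-≟ u x))) ⟩
      sum x + deg u * x u
        ≡⟨ cong (sum x +_) (*-comm (deg u) (x u)) ⟩
      sum x + x u * deg u ∎
      where
      open ≤-Reasoning
      factor : ∀ p q r s → (p + q + r) * s ≡ p * s + q * s + r * s
      factor = solve-∀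
      expand : ∀ p q s → (1 + p * q) * s ≡ s + q * (p * s)
      expand = solve-∀
      assoc-comm : ∀ p q s → p * (q * s) ≡ s * (p * q)
      assoc-comm = solve-∀
      AAx≡ : A (A x) u ≡ ∑[ w < n ] (codeg u w * x w)
      AAx≡ = ≡.begin
        ∑[ v < n ] (adj u v * A x v)
          ≡.≡⟨ sum-cong-≗ (λ v → *-distribˡ-sum (adj u v) λ w → adj v w * x w) ⟩
        ∑[ v < n ] ∑[ w < n ] (adj u v * (adj v w * x w))
          ≡.≡⟨ ∑-comm (λ v w → adj u v * (adj v w * x w)) ⟩
        ∑[ w < n ] ∑[ v < n ] (adj u v * (adj v w * x w))
          ≡.≡⟨ sum-cong-≗ (λ w → trans
                (sum-cong-≗ λ v → assoc-comm (adj u v) (adj v w) (x w))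
                (trans (∑-scale (x w) λ v → adj u v * adj v w) (*-comm (x w) (codeg u w)))) ⟩
        ∑[ w < n ] (codeg u w * x w) ≡.∎
        where module ≡ = ≡-Reasoning

    -- Pair `row-bound` with `x`; self-adjointness turns the term of A² into the squared norm of
    -- `A x`.
    form-bound : ∀ x → ∑[ u < n ] (A x u * A x u) + ∑[ u < n ] (x u * A x u) + ∑[ u < n ] (x u * x u)
                 ≤ sum x * sum x + ∑[ u < n ] (x u * (x u * deg u))
    form-bound x = begin
      ∑[ u < n ] (A x u * A x u) + ∑[ u < n ] (x u * A x u) + ∑[ u < n ] (x u * x u)
        ≡⟨ cong (λ s → s + ∑[ u < n ] (x u * A x u) + ∑[ u < n ] (x u * x u))
                (A-self-adjoint x (A x)) ⟨
      ∑[ u < n ] (x u * A (A x) u) + ∑[ u < n ] (x u * A x u) + ∑[ u < n ] (x u * x u)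
        ≡⟨ cong (_+ ∑[ u < n ] (x u * x u)) (∑-distrib-+ (λ u → x u * A (A x) u) _) ⟨
      ∑[ u < n ] (x u * A (A x) u + x u * A x u) + ∑[ u < n ] (x u * x u)
        ≡⟨ ∑-distrib-+ (λ u → x u * A (A x) u + x u * A x u) _ ⟨
      ∑[ u < n ] (x u * A (A x) u + x u * A x u + x u * x u)
        ≡⟨ sum-cong-≗ (λ u → factor (x u) (A (A x) u) (A x u) (x u)) ⟨
      ∑[ u < n ] (x u * (A (A x) u + A x u + x u))
        ≤⟨ ∑-mono (λ u → *-monoʳ-≤ (x u) (row-bound x u)) ⟩
      ∑[ u < n ] (x u * (sum x + x u * deg u))
        ≡⟨ sum-cong-≗ (λ u → expand (x u) (sum x) (x u * deg u)) ⟩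
      ∑[ u < n ] (sum x * x u + x u * (x u * deg u))
        ≡⟨ ∑-distrib-+ (λ u → sum x * x u) _ ⟩
      ∑[ u < n ] (sum x * x u) + ∑[ u < n ] (x u * (x u * deg u))
        ≡⟨ cong (_+ ∑[ u < n ] (x u * (x u * deg u))) (∑-scale (sum x) x) ⟩
      sum x * sum x + ∑[ u < n ] (x u * (x u * deg u)) ∎
      where
      open ≤-Reasoning
      factor : ∀ s p q r → s * (p + q + r) ≡ s * p + s * q + s * r
      factor = solve-∀
      expand : ∀ s p q → s * (p + q) ≡ p * s + s * q
      expand = solve-∀

    -- `row-bound` at the all-ones vector, where the diagonal term cancels `deg u`.
    neighbour-degrees : ∀ u → A deg u + 1 ≤ n
    neighbour-degrees u = +-cancelʳ-≤ (deg u) _ _ (begin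
      A deg u + 1 + deg u             ≡⟨ swap (A deg u) 1 (deg u) ⟩
      A deg u + deg u + 1             ≤⟨ row-bound (λ _ → 1) u ⟩
      ∑[ i < n ] 1 + 1 * deg u        ≡⟨ cong₂ _+_ (trans (∑-const n 1) (*-identityʳ n))
                                                   (*-identityˡ (deg u)) ⟩
      n + deg u                       ∎)
      where
      open ≤-Reasoning
      swap : ∀ p q r → p + q + r ≡ p + r + q
      swap = solve-∀

    -- Heavy vertices and the upper bound.

    private
      χ z m : Fin n → ℕ
      χ v = heavy (deg v)
      z = A χ
      m v = 6 ∸ deg v

      k D E F H Q : ℕ
      k = sum χ
      D = ∑[ v < n ] (χ v * deg v)
      E = sum deg
      F = sum m
      H = ∑[ v < n ] (χ v * z v)
      Q = ∑[ v < n ] (z v * z v)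

      χ² : ∀ v → χ v * χ v ≡ χ v
      χ² v = 𝟙-idem (7 ≤? deg v)

      sum-A : ∀ x → sum (A x) ≡ ∑[ v < n ] (deg v * x v)
      sum-A x = trans (sum-cong-≗ λ v → sym (*-identityˡ (A x v))) (A-self-adjoint (λ _ → 1) x)

      split : D + 6 * n ≡ E + 6 * k + F
      split = begin
        D + 6 * n
          ≡⟨ cong (D +_) (trans (*-comm 6 n) (sym (∑-const n 6))) ⟩
        D + ∑[ v < n ] 6
          ≡⟨ ∑-distrib-+ (λ v → χ v * deg v) _ ⟨
        ∑[ v < n ] (χ v * deg v + 6)
          ≡⟨ sum-cong-≗ (λ v → heavy-split (deg v)) ⟩
        ∑[ v < n ] (deg v + 6 * χ v + m v)
          ≡⟨ ∑-distrib-+ (λ v → deg v + 6 * χ v) m ⟩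
        ∑[ v < n ] (deg v + 6 * χ v) + F
          ≡⟨ cong (_+ F) (∑-distrib-+ deg λ v → 6 * χ v) ⟩
        E + ∑[ v < n ] (6 * χ v) + F
          ≡⟨ cong (λ s → E + s + F) (∑-scale 6 χ) ⟩
        E + 6 * k + F ∎
        where open ≡-Reasoning

      -- Count each neighbour of `v` as 6, plus 1 if heavy: by `6+heavy≤` this is at most the degree
      -- sum around `v` plus the deficiencies there.
      heavy-row : ∀ v → 6 * deg v + z v + 1 ≤ n + A m v
      heavy-row v = begin
        6 * deg v + z v + 1
          ≡⟨ cong (λ s → s + z v + 1) (A-scale 6 (λ _ → 1) v) ⟨
        A (λ _ → 6) v + z v + 1
          ≡⟨ cong (_+ 1) (A-+ (λ _ → 6) χ v) ⟨
        A (λ u → 6 + χ u) v + 1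
          ≤⟨ +-monoˡ-≤ 1 (A-mono (λ u → 6+heavy≤ (deg u)) v) ⟩
        A (λ u → deg u + m u) v + 1
          ≡⟨ cong (_+ 1) (A-+ deg m v) ⟩
        A deg v + A m v + 1
          ≡⟨ swap (A deg v) (A m v) 1 ⟩
        A deg v + 1 + A m v
          ≤⟨ +-monoˡ-≤ (A m v) (neighbour-degrees v) ⟩
        n + A m v ∎
        where
        open ≤-Reasoning
        swap : ∀ p q r → p + q + r ≡ p + r + q
        swap = solve-∀

      -- Extend the sum to all vertices; then each deficiency is counted once per neighbour, and
      -- only vertices of degree at most 5 contribute.
      light-neighbours : ∑[ v < n ] (χ v * A m v) ≤ 5 * F
      light-neighbours = begin
        ∑[ v < n ] (χ v * A m v)
          ≤⟨ ∑-mono (λ v → ≤-trans (*-monoˡ-≤ (A m v) (𝟙≤1 (7 ≤? deg v)))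
                                   (≤-reflexive (*-identityˡ (A m v)))) ⟩
        sum (A m)
          ≡⟨ sum-A m ⟩
        ∑[ v < n ] (deg v * m v)
          ≤⟨ ∑-mono (λ v → d*[6∸d]≤ (deg v)) ⟩
        ∑[ v < n ] (5 * m v)
          ≡⟨ ∑-scale 5 m ⟩
        5 * F ∎
        where open ≤-Reasoning

      -- `heavy-row` summed over the heavy vertices; this is the upper bound on H.
      rows : 6 * D + H + k ≤ n * k + 5 * F
      rows = begin
        6 * D + H + k
          ≡⟨ cong (λ s → s + H + k) (∑-scale 6 λ v → χ v * deg v) ⟨
        ∑[ v < n ] (6 * (χ v * deg v)) + H + k
          ≡⟨ cong (_+ k) (∑-distrib-+ (λ v → 6 * (χ v * deg v)) _) ⟨
        ∑[ v < n ] (6 * (χ v * deg v) + χ v * z v) + k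
          ≡⟨ ∑-distrib-+ (λ v → 6 * (χ v * deg v) + χ v * z v) χ ⟨
        ∑[ v < n ] (6 * (χ v * deg v) + χ v * z v + χ v)
          ≡⟨ sum-cong-≗ (λ v → factor (χ v) (deg v) (z v)) ⟩
        ∑[ v < n ] (χ v * (6 * deg v + z v + 1))
          ≤⟨ ∑-mono (λ v → *-monoʳ-≤ (χ v) (heavy-row v)) ⟩
        ∑[ v < n ] (χ v * (n + A m v))
          ≡⟨ sum-cong-≗ (λ v → expand (χ v) n (A m v)) ⟩
        ∑[ v < n ] (n * χ v + χ v * A m v)
          ≡⟨ ∑-distrib-+ (λ v → n * χ v) _ ⟩
        ∑[ v < n ] (n * χ v) + ∑[ v < n ] (χ v * A m v)
          ≤⟨ +-mono-≤ (≤-reflexive (∑-scale n χ)) light-neighbours ⟩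
        n * k + 5 * F ∎
        where
        open ≤-Reasoning
        factor : ∀ p d z → 6 * (p * d) + p * z + p ≡ p * (6 * d + z + 1)
        factor = solve-∀
        expand : ∀ p n q → p * (n + q) ≡ n * p + p * q
        expand = solve-∀

      form : Q + H + k ≤ k * k + D
      form = subst₂ (λ s t → Q + H + s ≤ k * k + t)
        (sum-cong-≗ χ²)
        (sum-cong-≗ λ v → trans (sym (*-assoc (χ v) (χ v) (deg v))) (cong (_* deg v) (χ² v)))
        (form-bound χ)

      -- `tangents` at each `z v`, summed; double counting gives ∑ z = D.
      tangent-sum : ∀ b c → let a = suc b + c in
        (2 * a + 1) * D + (suc b + a * (a + 1)) * k
          ≤ Q + H + (2 * c + 1) * H + (suc b * suc b * k + a * (a + 1) * n)
      tangent-sum b c = begin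
        s * D + t * k
          ≡⟨ cong₂ (λ x y → s * x + y)
               (trans (sum-cong-≗ λ v → *-comm (χ v) (deg v)) (sym (sum-A χ)))
               (sym (∑-scale t χ)) ⟩
        s * sum z + ∑[ v < n ] (t * χ v)
          ≡⟨ cong (_+ ∑[ v < n ] (t * χ v)) (∑-scale s z) ⟨
        ∑[ v < n ] (s * z v) + ∑[ v < n ] (t * χ v)
          ≡⟨ ∑-distrib-+ (λ v → s * z v) _ ⟨
        ∑[ v < n ] (s * z v + t * χ v)
          ≤⟨ ∑-mono (λ v → tangents b c (7 ≤? deg v) (z v)) ⟩
        ∑[ v < n ] (z v * z v + χ v * z v + γ * (χ v * z v) + (q * χ v + r))
          ≡⟨ ∑-distrib-+ (λ v → z v * z v + χ v * z v + γ * (χ v * z v)) _ ⟩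
        ∑[ v < n ] (z v * z v + χ v * z v + γ * (χ v * z v)) + ∑[ v < n ] (q * χ v + r)
          ≡⟨ cong₂ _+_ (∑-distrib-+ (λ v → z v * z v + χ v * z v) _) (∑-distrib-+ (λ v → q * χ v) _) ⟩
        ∑[ v < n ] (z v * z v + χ v * z v) + ∑[ v < n ] (γ * (χ v * z v))
          + (∑[ v < n ] (q * χ v) + ∑[ v < n ] r)
          ≡⟨ cong₂ _+_ (cong₂ _+_ (∑-distrib-+ (λ v → z v * z v) _) (∑-scale γ λ v → χ v * z v))
                       (cong₂ _+_ (∑-scale q χ) (trans (∑-const n r) (*-comm n r))) ⟩
        Q + H + γ * H + (q * k + r * n) ∎
        where
        open ≤-Reasoning
        a = suc b + c
        γ = 2 * c + 1
        s = 2 * a + 1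
        t = suc b + a * (a + 1)
        q = suc b * suc b
        r = a * (a + 1)

      k≤n : k ≤ n
      k≤n = begin
        k             ≤⟨ ∑-mono (λ v → 𝟙≤1 (7 ≤? deg v)) ⟩
        ∑[ v < n ] 1  ≡⟨ trans (∑-const n 1) (*-identityʳ n) ⟩
        n             ∎
        where open ≤-Reasoning

      7k≤D : 7 * k ≤ D
      7k≤D = ≤-trans (≤-reflexive (sym (∑-scale 7 χ))) (∑-mono λ v → 7heavy≤ (deg v))

    -- More than `e` edges force E ≥ 2(e + 1). The numerical check is made at this least value and
    -- carries over to the actual E and D, since its larger side increases with both.
    size≤ : ∀ e → Excluded n (2 * suc e) → size G ≤ e
    size≤ e excluded = ≮⇒≥ λ e<size →
      let E₀≤E : 2 * suc e ≤ E
          E₀≤E = ≤-trans (*-monoʳ-≤ 2 e<size) (≤-reflexive 2size≡∑deg)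
          ((b , c) , excludes) = satisfied (excluded (s≤s k≤n))
      in <⇒≱ excludes (≤-trans (lower (2 * suc e) b c E₀≤E)
           (eliminate n {E = E} {F = F} (suc b + c) (suc b) (2 * c + 1) split rows form (tangent-sum b c)))
      where
      D₀≤D : ∀ {E₀} → E₀ ≤ E → 7 * k ⊔ (E₀ + 6 * k ∸ 6 * n) ≤ D
      -- The second bound is `split` with F dropped.
      D₀≤D {E₀} E₀≤E = ⊔-lub 7k≤D (m≤n+o⇒m∸n≤o _ (6 * n) (begin
        E₀ + 6 * k     ≤⟨ +-monoˡ-≤ (6 * k) E₀≤E ⟩
        E + 6 * k      ≤⟨ m≤m+n _ F ⟩
        E + 6 * k + F  ≡⟨ split ⟨
        D + 6 * n      ≡⟨ +-comm D (6 * n) ⟩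
        6 * n + D      ∎))
        where open ≤-Reasoning
      lower : ∀ E₀ b c → E₀ ≤ E → let β = suc b ; a = β + c ; γ = 2 * c + 1 in
        γ * (31 * k + 5 * E₀) + (γ + 2 * a) * (7 * k ⊔ (E₀ + 6 * k ∸ 6 * n)) + (β + a * (a + 1)) * k + k
          ≤ γ * (31 * k + 5 * E) + (γ + 2 * a) * D + (β + a * (a + 1)) * k + k
      lower E₀ b c E₀≤E = +-monoˡ-≤ k (+-monoˡ-≤ _ (+-mono-≤
        (*-monoʳ-≤ (2 * c + 1) (+-monoʳ-≤ (31 * k) (*-monoʳ-≤ 5 E₀≤E)))
        (*-monoʳ-≤ (2 * c + 1 + 2 * (suc b + c)) (D₀≤D E₀≤E))))

-- The Hoffman–Singleton graph

-- Robertson's pentagons and pentagrams.  The pentagram Qᵢ has the vertices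
-- 5i + j (i, j < 5) and the pentagon Pₕ the vertices 25 + 5h + j; the vertex j
-- of Pₕ is joined to the vertex hi + j (mod 5) of Qᵢ.  Thus 45, …, 49 span a pentagon.
arc : ℕ → ℕ → Bool
arc u v = if v <ᵇ 25
  then (u <ᵇ 25) ∧ (u / 5 ≡ᵇ v / 5) ∧ (v % 5 ≡ᵇ (u + 2) % 5)
  else if u <ᵇ 25
  -- Here `v / 5` is 5 + h and `v` is 25 + 5h + j, so the right side is hi + j modulo 5.
  then u % 5 ≡ᵇ ((v / 5) * (u / 5) + v) % 5
  else (u / 5 ≡ᵇ v / 5) ∧ (v % 5 ≡ᵇ (u + 1) % 5)

edge : ℕ → ℕ → Bool
edge u v = arc u v ∨ arc v u

-- Girth of the Hoffman-Singleton graph by exhaustive evaluation.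

infixr 4 _⇒_
-- A false premise discards the conclusion unevaluated, so nested searches continue only along
-- edges.
_⇒_ : Bool → Bool → Bool
x ⇒ y = if x then y else true

⇒-elim : ∀ x {y} → T (x ⇒ y) → T x → T y
⇒-elim true p _ = p

all<50 : (ℕ → Bool) → Bool
all<50 p = all p (upTo 50)

all<50-elim : ∀ p → T (all<50 p) → ∀ {u} → u < 50 → T (p u)
all<50-elim p h u<50 = lookup (all⁺ p (upTo 50) h) (∈-upTo⁺ u<50)

-- The proof `tt` is accepted because the search over all 50 vertices evaluates to `true`.
loopless : ∀ {u} → u < 50 → T (not (edge u u))
loopless = all<50-elim (λ u → not (edge u u)) tt

triangle-free : ∀ {u v w} → u < 50 → v < 50 → w < 50 →
                T (edge u v) → T (edge v w) → T (not (edge w u))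
triangle-free {u} {v} {w} u< v< w< uv vw =
  ⇒-elim (edge v w)
    (all<50-elim (p₃ u v)
      (⇒-elim (edge u v) (all<50-elim (p₂ u) (all<50-elim p₁ tt u<) v<) uv) w<) vw
  where
  p₃ : ℕ → ℕ → ℕ → Bool
  p₃ u v w = edge v w ⇒ not (edge w u)
  p₂ : ℕ → ℕ → Bool
  p₂ u v = edge u v ⇒ all<50 (p₃ u v)
  p₁ : ℕ → Bool
  p₁ u = all<50 (p₂ u)

-- The search follows walks u, v, w and discards u = w before it ranges over x, which keeps the
-- evaluation small.
square-free : ∀ {u v w x} → u < 50 → v < 50 → w < 50 → x < 50 →
              T (edge u v) → T (edge v w) → T (edge w x) → T (edge x u) →
              u ≢ w → v ≡ x
square-free {u} {v} {w} {x} u< v< w< x< uv vw wx xu u≢w =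
  ≡ᵇ⇒≡ v x
    (⇒-elim (edge x u)
      (⇒-elim (edge w x)
        (all<50-elim (p₄ u v w)
          (⇒-elim (not (u ≡ᵇ w))
            (⇒-elim (edge v w)
              (all<50-elim (p₃ u v)
                (⇒-elim (edge u v) (all<50-elim (p₂ u) (all<50-elim p₁ tt u<) v<) uv)
                w<)
              vw)
            (≢⇒T-not u≢w))
          x<)
        wx)
      xu)
  where
  p₄ : ℕ → ℕ → ℕ → ℕ → Bool
  p₄ u v w x = edge w x ⇒ edge x u ⇒ (v ≡ᵇ x)
  p₃ : ℕ → ℕ → ℕ → Bool
  p₃ u v w = edge v w ⇒ not (u ≡ᵇ w) ⇒ all<50 (p₄ u v w)
  p₂ : ℕ → ℕ → Bool
  p₂ u v = edge u v ⇒ all<50 (p₃ u v)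
  p₁ : ℕ → Bool
  p₁ u = all<50 (p₂ u)
  ≢⇒T-not : u ≢ w → T (not (u ≡ᵇ w))
  ≢⇒T-not u≢w with u ≡ᵇ w in eq
  ... | false = tt
  ... | true  = contradiction (≡ᵇ⇒≡ u w (subst T (sym eq) tt)) u≢w

T-not : ∀ {b} → T (not b) → ¬ T b
T-not {false} _ ()

-- The subgraph induced on the numbers below `n`. For 45 ≤ n ≤ 49 the deleted vertices n, ..., 49
-- are consecutive on the last pentagon.
hoffmanSingleton : ∀ n → n ≤ 50 → Graph n
hoffmanSingleton n n≤50 = record
  { _~_    = λ i j → T (edge (toℕ i) (toℕ j))
  ; _~?_   = λ i j → T? (edge (toℕ i) (toℕ j))
  ; sym    = λ {i} {j} → subst T (∨-comm (arc (toℕ i) (toℕ j)) (arc (toℕ j) (toℕ i)))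
  ; irrefl = λ { {i} refl → T-not (loopless (<-≤-trans (toℕ<n i) n≤50)) }
  }

hoffmanSingleton-girth : ∀ n (n≤50 : n ≤ 50) → Girth≥5 (hoffmanSingleton n n≤50)
hoffmanSingleton-girth n n≤50 = no3 , no4
  where
  <50 : (i : Fin n) → toℕ i < 50
  <50 i = <-≤-trans (toℕ<n i) n≤50

  no3 : ¬ Cycle (hoffmanSingleton n n≤50) 3
  no3 C = T-not (triangle-free (<50 (vertex 0F)) (<50 (vertex 1F)) (<50 (vertex 2F))
                  (adjacent 0F) (adjacent 1F)) (adjacent 2F)
    where open Cycle C

  no4 : ¬ Cycle (hoffmanSingleton n n≤50) 4
  no4 C = contradiction (injective (toℕ-injective v₁≡v₃)) λ ()
    where
    open Cycle C
    v₁≡v₃ : toℕ (vertex 1F) ≡ toℕ (vertex 3F)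
    v₁≡v₃ = square-free (<50 (vertex 0F)) (<50 (vertex 1F)) (<50 (vertex 2F)) (<50 (vertex 3F))
      (adjacent 0F) (adjacent 1F) (adjacent 2F) (adjacent 3F)
      λ eq → contradiction (injective (toℕ-injective eq)) λ ()

-- The extremal values.

extremal : ∀ n e (n≤50 : n ≤ 50) → size (hoffmanSingleton n n≤50) ≡ e →
           Excluded n (2 * suc e) → T[C≤4⨾ n ]≡ e
extremal n e n≤50 size≡e excluded =
  (hoffmanSingleton n n≤50 , hoffmanSingleton-girth n n≤50 , size≡e) ,
  λ G girth → size≤ G girth e excluded

theorem1 : (T[C≤4⨾ 45 ]≡ 145) × (∀ (n : ℕ) → n ∈ 46 ∷ 47 ∷ 48 ∷ 49 ∷ [] → T[C≤4⨾ n ]≡ (6 * n ∸ 126))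
-- From 175 edges, deleting s consecutive vertices of the 5-cycle, 1 ≤ s ≤ 4, removes 7s - (s - 1),
-- which leaves 6n - 126. Deleting all five removes 35 - 5, leaving 145, one more than that formula
-- gives. Each checked degree sum is 2(e + 1), as 292 = 2 · 146.
theorem1 = extremal 45 145 (≤ᵇ⇒≤ _ _ tt) refl (toWitness {a? = excluded? 45 292} tt) , λ where
  _ (here refl) → extremal 46 150 (≤ᵇ⇒≤ _ _ tt) refl (toWitness {a? = excluded? 46 302} tt)
  _ (there (here refl)) → extremal 47 156 (≤ᵇ⇒≤ _ _ tt) refl (toWitness {a? = excluded? 47 314} tt)
  _ (there (there (here refl))) → extremal 48 162 (≤ᵇ⇒≤ _ _ tt) refl (toWitness {a? = excluded? 48 326} tt)
  _ (there (there (there (here refl)))) → extremal 49 168 (≤ᵇ⇒≤ _ _ tt) refl (toWitness {a? = excluded? 49 338} tt)
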